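{- Assume Markov induction and computable choice. Let $\chi:\mathbb{N}\to\nabla_0\mathbb{N}$ be an oracle and $R:\mathbb{N}\times\bigcirc_\chi\mathbb{N}\to\Omega_{\neg\neg}$ a relation such that for all $n:\mathbb{N}$, $\neg\neg\sum_{\mu:\bigcirc_\chi\mathbb{N}}R\,n\,\mu\to\left\|\sum_{\mu:\bigcirc_\chi\mathbb{N}}R\,n\,\mu\right\|$. Then there merely exists $e:\mathbb{N}$ such that for all $n:\mathbb{N}$, if $\neg\neg\sum_{\mu:\bigcirc_\chi\mathbb{N}}R\,n\,\mu$ then $\varphi_e(n)\downarrow$, $\psi^\chi(\varphi_e(n))\downarrow$, and $R\,n\,\psi^\chi(\varphi_e(n))$.
   Context: Setting: homotopy type theory with a univalent universe $\mathcal{U}$ of small types and higher inductive types. It is assumed that there is a small type $\Omega_{\neg\neg}:\mathcal{U}$ classifying $\neg\neg$-stable propositions. For a type $X$, $\nabla_0X$ is the type of $\xi:X\to\Omega_{\neg\neg}$ such that $\neg\neg\sum_{x:X}\xi(x)$ and $\prod_{x,y:X}\xi(x)\to\xi(y)\to\neg\neg(x=y)$; write $\xi\downarrow:=\sum_{x:X}\xi(x)$ and $\xi\downarrow=x$ for $\xi(x)$. The nullification at a family $B:A\to\mathcal{U}$ is the higher modality whose modal types are the $X$ with every constant map $X\to X^{B(a)}$ an equivalence. An oracle is a map $\chi:A\to\nabla_0B$; $\bigcirc_\chi$ is the nullification at $a\mapsto\chi(a)\downarrow$, with unit $\eta$; for every $n$ we have an element of $\bigcirc_\chi(\chi(n)\downarrow)$.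 Computability: a function $\varphi:\mathbb{N}\times\mathbb{N}\times\mathbb{N}\to\mathbb{N}+\{\bot\}$, written $\varphi_e^k(n)$, is postulated such that for all $e,n$ at most one $k$ has $\varphi_e^k(n)\in\mathbb{N}$; $\varphi_e(n)\downarrow=m$ means $\sum_k\varphi_e^k(n)=m$ and $\varphi_e(n)\downarrow$ means $\sum_m\varphi_e(n)\downarrow=m$. Computable choice (CC): for every $R:\mathbb{N}\times\mathbb{N}\to\Omega_{\neg\neg}$ with $\prod_n\left(\neg\neg\sum_m R\,n\,m\to\|\sum_m R\,n\,m\|\right)$ there merely exists $e$ such that for all $n$, if $\neg\neg\sum_m R\,n\,m$ then $\varphi_e(n)\downarrow$ and $R\,n\,\varphi_e(n)$. Markov induction (MI): with $\mathtt{IsSuc}(\mu,\nu):=\prod_{m}(\mu\downarrow=m)\to(\nu\downarrow=m+1)$ on $\nabla_0\mathbb{N}$, for every $P:\nabla_0\mathbb{N}\to\mathcal{U}$ and $h:\prod_\nu(\prod_\mu\mathtt{IsSuc}(\mu,\nu)\to P(\mu))\to P(\nu)$ there is a section $\prod_\nu P(\nu)$. The coding $\psi^\chi$: fix a bijection $\theta:\mathbb{N}\cong\mathbb{N}+(\mathbb{N}\times\mathbb{N})$. For lists $\vec k=[k_1,\dots,k_m]$ of naturals and $x:\mathbb{N}+\mathbb{N}\times\mathbb{N}$ define $\psi^\chi_{\vec k}(x):\bigcirc_\chi(\mathbb{N}+\{\bot\})$ by recursion on $m$: $\psi^\chi_{[]}(\mathrm{inl}(n))=\eta(n)$, $\psi^\chi_{[]}(\mathrm{inr}(\_))=\eta(\bot)$;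 for $m>0$, $\psi^\chi_{[k_1,\dots,k_m]}(\mathrm{inl}(n))=\eta(\bot)$, and $\psi^\chi_{[k_1,\dots,k_m]}(\mathrm{inr}(n,e))$ is defined inside $\bigcirc_\chi$ from the element of $\bigcirc_\chi(\chi(n)\downarrow)$: given $b$ with $\chi(n)\downarrow=b$, it is $\psi^\chi_{[k_1,\dots,k_{m-1}]}(\theta(c))$ if $\varphi_e^{k_m}(b)=c\in\mathbb{N}$, and $\eta(\bot)$ if $\varphi_e^{k_m}(b)=\bot$. For $e:\mathbb{N}$, $\psi^\chi(e)$ is the partial element of $\bigcirc_\chi\mathbb{N}$ with domain $\psi^\chi(e)\downarrow:=\bigcirc_\chi\sum_{\vec k}\sum_{n:\mathbb{N}}\psi^\chi_{\vec k}(\theta(e))=\eta(n)$ and value obtained by applying $\bigcirc_\chi$ to the projection to $n$; $\psi^\chi(e)\downarrow=z$ means the domain holds with value $z$, and when defined we also write $\psi^\chi(e)$ for its value. -}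

{-# OPTIONS --safe --without-K #-}
module Defs where

open import Axiom.Extensionality.Propositional using (Extensionality)
open import Data.List.Base using (List; []; _∷_)
open import Data.Maybe.Base using (Maybe; just; nothing; maybe′)
open import Data.Nat.Base using (ℕ; suc)
open import Data.Product.Base using (Σ; Σ-syntax; _×_; _,_; proj₁; proj₂)
open import Data.Sum.Base using (_⊎_; inj₁; inj₂)
open import Function.Base using (const; id; _∘_)
open import Function.Bundles using (_↔_; Inverse)
open import Level using (Level; _⊔_; Setω)
open import Relation.Binary.PropositionalEquality using (_≡_; refl)
open import Relation.Nullary using (¬_; Irrelevant; Stable)

private
  variable
    a b : Level

------------------------------------------------------------------------
-- Homotopy type theory.
--
-- Everything is developed without K, the univalent universe of small
-- types is Set, and `Irrelevant` (from the library) is "is a proposition".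
-- Univalence and the higher inductive types are not available in plain
-- Agda, so they are collected in the record `HoTT` below, over which the
-- rest of the development is parametrised.

IsContr : Set a → Set a
IsContr A = Σ[ x ∈ A ] (∀ y → x ≡ y)

IsEquiv : {A : Set a} {B : Set b} → (A → B) → Set (a ⊔ b)
IsEquiv {A = A} f = ∀ y → IsContr (Σ[ x ∈ A ] f x ≡ y)

infix 4 _≃_

_≃_ : Set a → Set b → Set (a ⊔ b)
A ≃ B = Σ (A → B) IsEquiv

id-equiv : (A : Set a) → A ≃ A
id-equiv A = id , λ y → (y , refl) , λ { (_ , refl) → refl }

idToEquiv : {A B : Set a} → A ≡ B → A ≃ B
idToEquiv {A = A} refl = id-equiv A

IsNull : {A : Set} → (A → Set) → Set b → Set b
IsNull {A = A} B X = (i : A) → IsEquiv (const {A = X} {B = B i})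

-- The nullification at B, by the introduction and (dependent) elimination
-- rules of the higher inductive type; the computation rule on η holds up
-- to the identity type.
record Nullification {A : Set} (B : A → Set) : Setω where
  field
    ○      : Set → Set
    η      : {X : Set} → X → ○ X
    ○-null : (X : Set) → IsNull B (○ X)
    ○-ind  : {X : Set} (P : ○ X → Set b) → (∀ z → IsNull B (P z)) →
             (∀ x → P (η x)) → ∀ z → P z
    ○-ind-η : {X : Set} (P : ○ X → Set b) (null : ∀ z → IsNull B (P z))
              (f : ∀ x → P (η x)) (x : X) → ○-ind P null f (η x) ≡ f x

  ○-bind : {X Y : Set} → (X → ○ Y) → ○ X → ○ Y
  ○-bind {Y = Y} f = ○-ind (λ _ → ○ Y) (λ _ → ○-null Y) f

  ○-map : {X Y : Set} → (X → Y) → ○ X → ○ Y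
  ○-map f = ○-bind (η ∘ f)

  -- X → X^{B(i)} is an equivalence for X = ○ (B i); this is the preimage
  -- of the unit.
  ○-generic : (i : A) → ○ (B i)
  ○-generic i = proj₁ (proj₁ (○-null (B i) i η))

record HoTT : Setω where
  infix 0 ∥_∥
  field
    funext     : Extensionality a b
    univalence : (A B : Set) → IsEquiv (idToEquiv {A = A} {B = B})

    ∥_∥     : Set a → Set a
    ∣_∣     : {A : Set a} → A → ∥ A ∥
    ∥∥-prop : {A : Set a} → Irrelevant ∥ A ∥
    ∥∥-rec  : {A : Set a} {P : Set b} → Irrelevant P → (A → P) → ∥ A ∥ → P

    nullification : {A : Set} (B : A → Set) → Nullification B

record StablePropClassifier : Set₁ where
  field
    Ω¬¬        : Set
    decode     : Ω¬¬ → Σ[ P ∈ Set ] (Irrelevant P × Stable P)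
    classifies : IsEquiv decode

  El : Ω¬¬ → Set
  El p = proj₁ (decode p)

------------------------------------------------------------------------
-- ∇₀ and Markov induction

module Nabla (Ω : StablePropClassifier) where
  open StablePropClassifier Ω public

  record ∇₀ (X : Set) : Set where
    field
      ξ          : X → Ω¬¬
      inhabited  : ¬ ¬ (Σ[ x ∈ X ] El (ξ x))
      functional : ∀ x y → El (ξ x) → El (ξ y) → ¬ ¬ (x ≡ y)

  infix 5 _↓ _↓=_

  _↓=_ : {X : Set} → ∇₀ X → X → Set
  ν ↓= x = El (∇₀.ξ ν x)

  _↓ : {X : Set} → ∇₀ X → Set
  _↓ {X} ν = Σ[ x ∈ X ] ν ↓= x

  IsSuc : ∇₀ ℕ → ∇₀ ℕ → Set
  IsSuc μ ν = ∀ m → μ ↓= m → ν ↓= suc m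

  MarkovInduction : Set₁
  MarkovInduction = (P : ∇₀ ℕ → Set) →
    (∀ ν → (∀ μ → IsSuc μ ν → P μ) → P ν) → ∀ ν → P ν

------------------------------------------------------------------------
-- Computability

-- `step e k n` is φ_e^k(n), with `nothing` for ⊥.
record Computability : Set where
  field
    step        : (e k n : ℕ) → Maybe ℕ
    step-unique : ∀ e n {k l x y} →
                  step e k n ≡ just x → step e l n ≡ just y → k ≡ l

  φ_⟨_⟩↓=_ : (e n m : ℕ) → Set
  φ e ⟨ n ⟩↓= m = Σ[ k ∈ ℕ ] step e k n ≡ just m

  φ_⟨_⟩↓ : (e n : ℕ) → Set
  φ e ⟨ n ⟩↓ = Σ[ m ∈ ℕ ] φ e ⟨ n ⟩↓= m

  φ-value : ∀ {e n} → φ e ⟨ n ⟩↓ → ℕ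
  φ-value = proj₁

------------------------------------------------------------------------
-- Oracles

module Oracles (hott : HoTT) (Ω : StablePropClassifier)
               (comp : Computability) (θ : ℕ ↔ (ℕ ⊎ ℕ × ℕ)) where
  open HoTT hott public
  open Nabla Ω public
  open Computability comp public

  ComputableChoice : Set
  ComputableChoice = (R : ℕ → ℕ → Ω¬¬) →
    (∀ n → ¬ ¬ (Σ[ m ∈ ℕ ] El (R n m)) → ∥ Σ[ m ∈ ℕ ] El (R n m) ∥) →
    ∥ Σ[ e ∈ ℕ ] (∀ n → ¬ ¬ (Σ[ m ∈ ℕ ] El (R n m)) →
        Σ[ d ∈ φ e ⟨ n ⟩↓ ] El (R n (φ-value d))) ∥

  Oracle : Set → Set → Set
  Oracle A B = A → ∇₀ B

  module Modality {A B : Set} (χ : Oracle A B) =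
    Nullification (nullification (λ i → χ i ↓))

  ○[_] : {A B : Set} → Oracle A B → Set → Set
  ○[ χ ] = Modality.○ χ

  module _ (χ : Oracle ℕ ℕ) where
    open Modality χ

    -- The recursion removes the last entry k_m of [k_1,…,k_m], so the
    -- list is stored in reverse, with k_m at the head.
    ψ-run : List ℕ → ℕ ⊎ ℕ × ℕ → ○ (Maybe ℕ)
    ψ-run []       (inj₁ n)       = η (just n)
    ψ-run []       (inj₂ _)       = η nothing
    ψ-run (_ ∷ _)  (inj₁ _)       = η nothing
    ψ-run (k ∷ ks) (inj₂ (n , e)) = ○-bind
      (λ (b , _) → maybe′ (λ c → ψ-run ks (Inverse.to θ c)) (η nothing)
                          (step e k b))
      (○-generic n)

    ψ-halts : ℕ → Set
    ψ-halts e = Σ[ ks ∈ List ℕ ] Σ[ n ∈ ℕ ]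
                  ψ-run ks (Inverse.to θ e) ≡ η (just n)

    ψ_↓ : ℕ → Set
    ψ e ↓ = ○ (ψ-halts e)

    ψ-value : ∀ {e} → ψ e ↓ → ○ ℕ
    ψ-value = ○-map (λ (_ , n , _) → n)

{-# OPTIONS --without-K #-}
-- Oracle types χ(n)↓ are ¬¬-dense, so ○_χ is trivial under ¬¬ and its unit is
-- injective up to ¬¬ (because Ω¬¬ is modal); hence a code e has at most one
-- computation ψ(e), up to ¬¬.
--
-- Surjectivity: the set of μ : ○_χ ℕ that merely have a code (with a
-- computation not not existing) contains every η(n), and computable choice says
-- exactly that it is closed under the constructor of the nullification at χ(n)↓:
-- codes for the family of subtrees are computed by a single index e, and (n, e)
-- codes the whole tree.
--
-- Stability: if ¬¬ ψ(e)↓, the length of the computation is an element of ∇₀ ℕ.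
-- Markov induction on it gives ψ(e)↓, with Markov's principle (itself an
-- instance of the same induction) used to find the next step.
--
-- Computable choice applied to the ¬¬-stable relation "e codes some μ with
-- R n μ" then yields the theorem.
module Submission where

open import Defs
open import Data.Empty using (⊥-elim)
open import Data.List.Base using (List; []; _∷_; length)
open import Data.Maybe.Base using (just; nothing; maybe′)
open import Data.Maybe.Properties using (just-injective)
open import Data.Nat.Base using (ℕ; zero; suc; _+_)
open import Data.Nat.Properties using (+-suc; +-cancelˡ-≡; _≟_)
open import Data.Product.Base using (Σ-syntax; _×_; _,_; proj₁; proj₂)
open import Data.Sum.Base using (_⊎_; inj₁; inj₂)
open import Effect.Monad using (RawMonad)
open import Function.Base using (const; _∘_)
open import Function.Bundles using (_↔_; Inverse; mk↔ₛ′)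
import Function.Properties.Inverse.HalfAdjointEquivalence as HalfAdjoint
open import Level using (0ℓ)
open import Relation.Binary.PropositionalEquality
  using (_≡_; refl; sym; trans; cong; cong-app; subst)
import Axiom.UniquenessOfIdentityProofs as UIP
open import Relation.Nullary using (¬_; Irrelevant; Stable)
open import Relation.Nullary.Decidable using (decidable-stable)
open import Relation.Nullary.Negation using (¬¬-map; ¬¬-Monad; negated-stable)

open RawMonad (¬¬-Monad {0ℓ}) using (_>>=_; pure)

-- Equivalences and propositions without K

inverse⇒IsEquiv : ∀ {a b} {A : Set a} {B : Set b} (f : A → B) (g : B → A) →
                  (∀ y → f (g y) ≡ y) → (∀ x → g (f x) ≡ x) → IsEquiv f
inverse⇒IsEquiv {A = A} f g fg gf y =
  (g y , E.right-inverse-of y) , λ { (x , refl) →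
    -- The triangle identity of a half adjoint equivalence rewrites `right-inverse-of (f x)` as
    -- `cong f` of a path, which can then be contracted.
    trans (cong (λ p → g (f x) , p) (sym (E.left-right x)))
          (fibre-path (E.left-inverse-of x)) }
  where
  module E = HalfAdjoint._≃_ (HalfAdjoint.↔⇒≃ (mk↔ₛ′ f g fg gf))

  fibre-path : ∀ {x x′ : A} (p : x′ ≡ x) →
               _≡_ {A = Σ[ u ∈ A ] f u ≡ f x} (x′ , cong f p) (x , refl)
  fibre-path refl = refl

IsEquiv⇒injective : ∀ {a b} {A : Set a} {B : Set b} {f : A → B} → IsEquiv f →
                    ∀ {x y} → f x ≡ f y → x ≡ y
IsEquiv⇒injective {f = f} f-equiv {x} {y} p = cong proj₁
  (trans (sym (proj₂ (f-equiv (f y)) (x , p))) (proj₂ (f-equiv (f y)) (y , refl)))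

-- Hedberg's argument: `A-prop x y` gives an endomap of `x ≡ y` that ignores its argument.
≡-irrelevant : ∀ {a} {A : Set a} → Irrelevant A → UIP.UIP A
≡-irrelevant A-prop =
  UIP.Constant⇒UIP.≡-irrelevant (λ {x} {y} _ → A-prop x y) (λ _ _ → refl)

-- Extensionality and the classifier of stable propositions

module Extensional (hott : HoTT) where
  open HoTT hott

  ¬-irrelevant : {A : Set} → Irrelevant (¬ A)
  ¬-irrelevant f g = funext (λ x → ⊥-elim (f x))

  irrelevant-null : ∀ {b} {A : Set} {B : A → Set} {X : Set b} → Irrelevant X →
                    (∀ i → (B i → X) → X) → IsNull B X
  irrelevant-null X-prop glue i = inverse⇒IsEquiv const (glue i)
    (λ f → funext (λ d → X-prop _ (f d))) (λ x → X-prop _ x)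

  propext : {P Q : Set} → Irrelevant P → Irrelevant Q →
            (P → Q) → (Q → P) → P ≡ Q
  propext P-prop Q-prop f g = proj₁ (proj₁ (univalence _ _
    (f , inverse⇒IsEquiv f g (λ q → Q-prop _ q) (λ p → P-prop _ p))))

  IsStableProp : Set → Set
  IsStableProp P = Irrelevant P × Stable P

  IsStableProp-irrelevant : {P : Set} → Irrelevant (IsStableProp P)
  IsStableProp-irrelevant (i , s) (i′ , s′)
    with funext (λ p → funext (λ q → ≡-irrelevant i (i p q) (i′ p q)))
       | funext (λ h → i (s h) (s′ h))
  ... | refl | refl = refl

  module Classifier (Ω : StablePropClassifier) where
    open StablePropClassifier Ω

    El-irrelevant : ∀ p → Irrelevant (El p)
    El-irrelevant p = proj₁ (proj₂ (decode p))

    El-stable : ∀ p → Stable (El p)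
    El-stable p = proj₂ (proj₂ (decode p))

    -- `decode` is injective, and the decoded pairs agree by univalence, their second components
    -- being proofs of a proposition.
    Ω¬¬-ext : ∀ {p q} → (El p → El q) → (El q → El p) → p ≡ q
    Ω¬¬-ext {p} {q} f g = IsEquiv⇒injective classifies
      (pair-≡ (propext (El-irrelevant p) (El-irrelevant q) f g) _ _)
      where
      pair-≡ : ∀ {P Q : Set} → P ≡ Q → (s : IsStableProp P) (t : IsStableProp Q) →
               _≡_ {A = Σ[ P ∈ Set ] IsStableProp P} (P , s) (Q , t)
      pair-≡ refl s t = cong (_ ,_) (IsStableProp-irrelevant s t)

    preimage : (P : Set) → Σ[ p ∈ Ω¬¬ ] decode p ≡ ((¬ ¬ P) , ¬-irrelevant , negated-stable)
    preimage P = proj₁ (classifies _)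

    -- The code of the double negation of `P`. It decodes to it only up to a path, so `encode` and
    -- `reveal` are transports.
    ⌜_⌝ : Set → Ω¬¬
    ⌜ P ⌝ = proj₁ (preimage P)

    El-⌜⌝ : (P : Set) → El ⌜ P ⌝ ≡ (¬ ¬ P)
    El-⌜⌝ P = cong proj₁ (proj₂ (preimage P))

    encode : {P : Set} → ¬ ¬ P → El ⌜ P ⌝
    encode {P} = subst (λ X → X) (sym (El-⌜⌝ P))

    reveal : {P : Set} → El ⌜ P ⌝ → ¬ ¬ P
    reveal {P} = subst (λ X → X) (El-⌜⌝ P)

  -- Nullification at dense propositions

  module DenseNullification (Ω : StablePropClassifier) {A : Set} {B : A → Set}
    (B-irrelevant : ∀ i → Irrelevant (B i)) (B-dense : ∀ i → ¬ ¬ B i)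
    (N : Nullification B) where
    open StablePropClassifier Ω
    open Classifier Ω
    open Nullification N

    -- A family `F` on `B i` is glued to the claim that `F` holds somewhere. As `B i` is a
    -- proposition, this agrees with every `F d`; as `B i` is dense, a constant family glues back to
    -- its value.
    Ω¬¬-null : IsNull B Ω¬¬
    Ω¬¬-null i = inverse⇒IsEquiv const (λ F → ⌜ Σ[ d ∈ B i ] El (F d) ⌝)
      (λ F → funext λ d → Ω¬¬-ext
        (λ x → El-stable (F d) (¬¬-map (λ (d′ , y) →
          subst (El ∘ F) (B-irrelevant i d′ d) y) (reveal x)))
        (λ y → encode (pure (d , y))))
      (λ p → Ω¬¬-ext
        (λ x → El-stable p (¬¬-map proj₂ (reveal x)))
        (λ y → encode (¬¬-map (_, y) (B-dense i))))

    -- Encode-decode: nullity of `Ω¬¬` extends the family `⌜ x ≡ y ⌝` in `y` to all of `○ X`, and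
    -- transport along `p` carries reflexivity across.
    η-injective : {X : Set} {x y : X} → η x ≡ η y → ¬ ¬ (x ≡ y)
    η-injective {X} {x} {y} p =
      reveal (subst El (code-η y) (subst (El ∘ code) p
        (subst El (sym (code-η x)) (encode (pure refl)))))
      where
      code : ○ X → Ω¬¬
      code = ○-ind (λ _ → Ω¬¬) (λ _ → Ω¬¬-null) (λ y → ⌜ x ≡ y ⌝)

      code-η : ∀ y → code (η y) ≡ ⌜ x ≡ y ⌝
      code-η = ○-ind-η (λ _ → Ω¬¬) (λ _ → Ω¬¬-null) (λ y → ⌜ x ≡ y ⌝)

    -- A double negation is null because `B i` is dense, so it may be proved on units alone.
    η-dense : {X : Set} (z : ○ X) → ¬ ¬ (Σ[ x ∈ X ] η x ≡ z)
    η-dense = ○-ind (λ z → ¬ ¬ (Σ[ x ∈ _ ] η x ≡ z))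
      (λ _ → irrelevant-null ¬-irrelevant (λ i f → B-dense i >>= f))
      (λ x → pure (x , refl))

    ○-bind-η : {X Y : Set} (f : X → ○ Y) (x : X) → ○-bind f (η x) ≡ f x
    ○-bind-η f x = ○-ind-η _ _ f x

    ○-generic-η : ∀ i (d : B i) → ○-generic i ≡ η d
    ○-generic-η i d = cong-app (proj₂ (proj₁ (○-null (B i) i η))) d

-- Markov induction and Markov's principle

module Markov (hott : HoTT) (Ω : StablePropClassifier) where
  open Nabla Ω
  open Extensional hott
  open Classifier Ω

  -- `D t m` reads as: `t` has rank `m`. The rank is known only up to double negation, hence is a
  -- point of `∇₀ ℕ`, where Markov induction applies.
  ranked-induction : MarkovInduction →
    {T : Set} (D : T → ℕ → Set) → (∀ t {m n} → D t m → D t n → ¬ ¬ (m ≡ n)) →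
    (G : T → Set) →
    (∀ t → ¬ ¬ (Σ[ m ∈ ℕ ] D t m) →
      (∀ u → ¬ ¬ (Σ[ m ∈ ℕ ] D u m) → (∀ m → D u m → ¬ ¬ D t (suc m)) → G u) →
      G t) →
    ∀ t → ¬ ¬ (Σ[ m ∈ ℕ ] D t m) → G t
  ranked-induction MI {T} D D-functional G step t ranked =
    MI P go (rank t ranked) t ranked (λ _ d → encode (pure d))
    where
    rank : ∀ t → ¬ ¬ (Σ[ m ∈ ℕ ] D t m) → ∇₀ ℕ
    rank t ranked = record
      { ξ          = λ m → ⌜ D t m ⌝
      ; inhabited  = ¬¬-map (λ (m , d) → m , encode (pure d)) ranked
      ; functional = λ _ _ x y → do
          d ← reveal x
          d′ ← reveal y
          D-functional t d d′
      }

    -- Quantifying over every `t` whose ranks lie in `ν` avoids any equality between `ν` and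
    -- `rank t`.
    P : ∇₀ ℕ → Set
    P ν = ∀ t → ¬ ¬ (Σ[ m ∈ ℕ ] D t m) → (∀ m → D t m → ν ↓= m) → G t

    go : ∀ ν → (∀ μ → IsSuc μ ν → P μ) → P ν
    go ν ih t ranked D⊆ν = step t ranked λ u ranked-u below →
      ih (rank u ranked-u)
         (λ m x → El-stable (∇₀.ξ ν (suc m)) (do
           d ← reveal x
           d′ ← below m d
           pure (D⊆ν (suc m) d′)))
         u ranked-u (λ _ d → encode (pure d))

  module _ (comp : Computability) where
    open Computability comp

    -- Search upwards from stage 0. The rank of `j` is the distance still to go to the halting
    -- stage, which drops by one with each failed test.
    markov-principle : MarkovInduction → ∀ e n → ¬ ¬ (φ e ⟨ n ⟩↓) → φ e ⟨ n ⟩↓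
    markov-principle MI e n halts =
      ranked-induction MI D D-functional (λ _ → φ e ⟨ n ⟩↓) search 0
        (¬¬-map (λ (c , k , p) → k , c , p) halts)
      where
      D : ℕ → ℕ → Set
      D j m = Σ[ c ∈ ℕ ] step e (j + m) n ≡ just c

      D-functional : ∀ j {m m′} → D j m → D j m′ → ¬ ¬ (m ≡ m′)
      D-functional j {m} {m′} (_ , p) (_ , q) =
        pure (+-cancelˡ-≡ j m m′ (step-unique e n p q))

      shift : ∀ j m {x} → step e (suc (j + m)) n ≡ x → step e (j + suc m) n ≡ x
      shift j m {x} = subst (λ k → step e k n ≡ x) (sym (+-suc j m))

      search : ∀ j → ¬ ¬ (Σ[ m ∈ ℕ ] D j m) →
               (∀ j′ → ¬ ¬ (Σ[ m ∈ ℕ ] D j′ m) →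
                 (∀ m → D j′ m → ¬ ¬ D j (suc m)) → φ e ⟨ n ⟩↓) →
               φ e ⟨ n ⟩↓
      search j ranked later with step e (j + 0) n in now
      ... | just c  = c , j + 0 , now
      ... | nothing = later (suc j)
        (ranked >>= λ where
          -- Rank zero would mean halting at stage `j`, where the test has just failed.
          (zero  , _ , p) → λ _ → case-nothing (trans (sym now) p)
          (suc m , c , p) → pure (m , c , subst (λ k → step e k n ≡ just c) (+-suc j m) p))
        (λ m (c , p) → pure (c , shift j m p))
        where
        case-nothing : ∀ {c : ℕ} {X : Set} → nothing ≡ just c → X
        case-nothing ()

-- Runs of coded oracle computations

module Coding (hott : HoTT) (Ω : StablePropClassifier)
              (comp : Computability) (θ : ℕ ↔ (ℕ ⊎ ℕ × ℕ)) where
  open Oracles hott Ω comp θ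
  open Extensional hott
  open Classifier Ω
  open Markov hott Ω
  open Inverse θ using (to; from; strictlyInverseˡ)

  module _ (MI : MarkovInduction) (CC : ComputableChoice) (χ : Oracle ℕ ℕ) where
    open Modality χ

    χ↓-irrelevant : ∀ i → Irrelevant (χ i ↓)
    χ↓-irrelevant i (b , p) (b′ , p′)
      with decidable-stable (b ≟ b′) (∇₀.functional (χ i) b b′ p p′)
    ... | refl = cong (b ,_) (El-irrelevant (∇₀.ξ (χ i) b) p p′)

    open DenseNullification Ω χ↓-irrelevant (λ i → ∇₀.inhabited (χ i))
           (nullification (λ i → χ i ↓))

    -- Given an answer `b`, the generic element is the unit at `b`, so the bind computes.
    ψ-run-∷ : ∀ k ks {i e b} → χ i ↓= b →
              ψ-run χ (k ∷ ks) (inj₂ (i , e)) ≡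
              maybe′ (λ c → ψ-run χ ks (to c)) (η nothing) (step e k b)
    ψ-run-∷ k ks {b = b} p = trans (cong (○-bind _) (○-generic-η _ (b , p))) (○-bind-η _ _)

    ψ-run-step : ∀ k ks {i e b c} → χ i ↓= b → step e k b ≡ just c →
                 ψ-run χ (k ∷ ks) (inj₂ (i , e)) ≡ ψ-run χ ks (to c)
    ψ-run-step k ks p s =
      trans (ψ-run-∷ k ks p) (cong (maybe′ (λ c → ψ-run χ ks (to c)) (η nothing)) s)

    ψ-run-unstep : ∀ k ks {i e b n} → χ i ↓= b →
                   ψ-run χ (k ∷ ks) (inj₂ (i , e)) ≡ η (just n) →
                   ¬ ¬ (Σ[ c ∈ ℕ ] step e k b ≡ just c × ψ-run χ ks (to c) ≡ η (just n))
    ψ-run-unstep k ks {e = e} {b} p r with step e k b | trans (sym (ψ-run-∷ k ks p)) r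
    ... | just c  | r′ = pure (c , refl , r′)
    ... | nothing | r′ = η-injective r′ >>= λ ()

    -- The goal is a double negation, so the oracle's answer may be assumed. `step-unique` then
    -- forces equal stages and equal next codes, and the tails are compared recursively. Lists of
    -- the wrong shape yield `η nothing`.
    ψ-run-unique : ∀ ks ks′ x {n n′} →
                   ψ-run χ ks x ≡ η (just n) → ψ-run χ ks′ x ≡ η (just n′) →
                   ¬ ¬ (ks ≡ ks′ × n ≡ n′)
    ψ-run-unique [] [] (inj₁ _) r r′ =
      ¬¬-map (λ p → refl , just-injective p) (η-injective (trans (sym r) r′))
    ψ-run-unique [] _ (inj₂ _) r _ = η-injective r >>= λ ()
    ψ-run-unique _ [] (inj₂ _) _ r′ = η-injective r′ >>= λ ()
    ψ-run-unique _ (_ ∷ _) (inj₁ _) _ r′ = η-injective r′ >>= λ ()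
    ψ-run-unique (_ ∷ _) _ (inj₁ _) r _ = η-injective r >>= λ ()
    ψ-run-unique (k ∷ ks) (k′ ∷ ks′) (inj₂ (i , e)) r r′ = do
      b , p ← ∇₀.inhabited (χ i)
      c , s , t ← ψ-run-unstep k ks p r
      c′ , s′ , t′ ← ψ-run-unstep k′ ks′ p r′
      same s s′ t t′
      where
      same : ∀ {b c c′ n n′} → step e k b ≡ just c → step e k′ b ≡ just c′ →
             ψ-run χ ks (to c) ≡ η (just n) → ψ-run χ ks′ (to c′) ≡ η (just n′) →
             ¬ ¬ (k ∷ ks ≡ k′ ∷ ks′ × n ≡ n′)
      same {c = c} s s′ t t′ with step-unique e _ s s′
      ... | refl with just-injective (trans (sym s) s′)
      ... | refl = ¬¬-map (λ { (refl , q) → refl , q })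
                          (ψ-run-unique ks ks′ (to c) t t′)

    -- Stability of halting

    HaltsIn : ℕ → ℕ → Set
    HaltsIn e m = Σ[ ks ∈ List ℕ ] length ks ≡ m ×
                  (Σ[ n ∈ ℕ ] ψ-run χ ks (to e) ≡ η (just n))

    HaltsIn-functional : ∀ e {m m′} → HaltsIn e m → HaltsIn e m′ → ¬ ¬ (m ≡ m′)
    HaltsIn-functional e (ks , refl , _ , r) (ks′ , refl , _ , r′) =
      ¬¬-map (λ (p , _) → cong length p) (ψ-run-unique ks ks′ (to e) r r′)

    ψ↓-stable : ∀ e → ¬ ¬ ψ-halts χ e → (ψ χ ↓) e
    ψ↓-stable e halts = ranked-induction MI HaltsIn HaltsIn-functional (ψ χ ↓) go e
      (¬¬-map (λ (ks , n , r) → length ks , ks , refl , n , r) halts)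
      where
      go : ∀ e → ¬ ¬ (Σ[ m ∈ ℕ ] HaltsIn e m) →
           (∀ c → ¬ ¬ (Σ[ m ∈ ℕ ] HaltsIn c m) →
             (∀ m → HaltsIn c m → ¬ ¬ HaltsIn e (suc m)) → (ψ χ ↓) c) →
           (ψ χ ↓) e
      go e ranked ih with to e
      ... | inj₁ n       = η ([] , n , refl)
      -- The goal lies in `○`, so the oracle's answer can be used even though the run may depend on
      -- it.
      ... | inj₂ (i , e₀) = ○-bind follow (○-generic i)
        where
        next : ∀ {b} → χ i ↓= b →
               ¬ ¬ (Σ[ k ∈ ℕ ] Σ[ c ∈ ℕ ] step e₀ k b ≡ just c ×
                    (Σ[ m ∈ ℕ ] HaltsIn c m))
        next p = ranked >>= λ where
          (_ , []     , _ , _ , r) → η-injective r >>= λ ()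
          (_ , k ∷ ks , _ , n , r) →
            ¬¬-map (λ (c , s , t) → k , c , s , _ , ks , refl , n , t)
                   (ψ-run-unstep k ks p r)

        follow : χ i ↓ → ○ (Σ[ ks ∈ List ℕ ] Σ[ n ∈ ℕ ]
                            ψ-run χ ks (inj₂ (i , e₀)) ≡ η (just n))
        follow (b , p) =
          -- The next code is known only up to double negation; Markov's principle produces an
          -- actual `c` to feed to `ih`.
          let c , k , s = markov-principle comp MI e₀ b
                (¬¬-map (λ (k , c , s , _) → c , k , s) (next p))
          in ○-map (λ (ks , n , r) → k ∷ ks , n , trans (ψ-run-step k ks p s) r)
               (ih c
                 -- The code `c′` taken from an assumed run equals the `c` found by search.
                 (next p >>= λ (k′ , c′ , s′ , h) → pure (subst (λ c → Σ[ m ∈ ℕ ] HaltsIn c m)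
                   (same-value s′ s) h))
                 (λ { _ (ks , refl , n , r) →
                   pure (k ∷ ks , refl , n , trans (ψ-run-step k ks p s) r) }))
          where
          same-value : ∀ {k k′ c c′} → step e₀ k b ≡ just c → step e₀ k′ b ≡ just c′ → c ≡ c′
          same-value s s′ with step-unique e₀ b s s′
          ... | refl = just-injective (trans (sym s) s′)

    -- Codes for elements of `○ ℕ`

    Codes : ℕ → ○ ℕ → Set
    Codes e μ = Σ[ ks ∈ List ℕ ] Σ[ n ∈ ℕ ]
                  (ψ-run χ ks (to e) ≡ η (just n) × η n ≡ μ)

    -- By density `z` is the unit at some run, and uniqueness of runs matches its value with that of
    -- the code.
    Codes⇒ψ-value : ∀ {e μ} → Codes e μ → (z : (ψ χ ↓) e) → ¬ ¬ (ψ-value χ z ≡ μ)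
    Codes⇒ψ-value {e} {μ} (ks , n , r , q) z = do
      (ks′ , n′ , r′) , refl ← η-dense z
      _ , n≡n′ ← ψ-run-unique ks ks′ (to e) r r′
      pure (trans (○-bind-η _ _) (trans (cong η (sym n≡n′)) q))

    codes-η : ∀ n → Codes (from (inj₁ n)) (η n)
    codes-η n = [] , n , cong (ψ-run χ []) (strictlyInverseˡ (inj₁ n)) , refl

    codes-node : ∀ {i e k b c μ} → χ i ↓= b → step e k b ≡ just c →
                 Codes c μ → Codes (from (inj₂ (i , e))) μ
    codes-node {i} {e} {k} p s (ks , n , r , q) = k ∷ ks , n ,
      trans (cong (ψ-run χ (k ∷ ks)) (strictlyInverseˡ (inj₂ (i , e))))
            (trans (ψ-run-step k ks p s) r) , q

    ∥∥-map : {X Y : Set} → (X → Y) → ∥ X ∥ → ∥ Y ∥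
    ∥∥-map f = ∥∥-rec ∥∥-prop (∣_∣ ∘ f)

    -- Induction on `μ`: the predicate is a proposition, so its nullity reduces to gluing codes that
    -- depend on the oracle's answer.
    codes-surjective : ∀ μ → ∥ Σ[ e ∈ ℕ ] ¬ ¬ Codes e μ ∥
    codes-surjective = ○-ind (λ μ → ∥ Σ[ e ∈ ℕ ] ¬ ¬ Codes e μ ∥)
      (λ μ → irrelevant-null ∥∥-prop (glue μ))
      (λ n → ∣ from (inj₁ n) , pure (codes-η n) ∣)
      where
      glue : ∀ μ i → (χ i ↓ → ∥ Σ[ e ∈ ℕ ] ¬ ¬ Codes e μ ∥) →
             ∥ Σ[ e ∈ ℕ ] ¬ ¬ Codes e μ ∥
      glue μ i f = ∥∥-map
        (λ (e , total) → from (inj₂ (i , e)) , (do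
          -- Correctness is claimed only up to double negation, so the answer and its code may be
          -- named.
          b , p ← ∇₀.inhabited (χ i)
          c , C ← ¬¬-untruncate (f (b , p))
          code ← C
          let (_ , _ , s) , x = total b (pure (c , encode (pure (p , code))))
          _ , code′ ← reveal x
          pure (codes-node p s code′)))
        (CC (λ b c → ⌜ χ i ↓= b × Codes c μ ⌝)
            (λ b h →
              -- The premise `h` already shows, by stability, that `b` is the answer, so `f` can be
              -- called.
              let p = El-stable (∇₀.ξ (χ i) b) (h >>= λ (_ , x) → ¬¬-map proj₁ (reveal x))
              in ∥∥-map (λ (c , C) → c , encode (¬¬-map (p ,_) C)) (f (b , p))))
        where
        ¬¬-untruncate : {X : Set} → ∥ X ∥ → ¬ ¬ X
        ¬¬-untruncate = ∥∥-rec ¬-irrelevant pure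

    oracle-choice : (R : ℕ → ○ ℕ → Ω¬¬) →
      (∀ n → ¬ ¬ (Σ[ μ ∈ ○ ℕ ] El (R n μ)) → ∥ Σ[ μ ∈ ○ ℕ ] El (R n μ) ∥) →
      ∥ Σ[ e ∈ ℕ ] (∀ n → ¬ ¬ (Σ[ μ ∈ ○ ℕ ] El (R n μ)) →
          Σ[ d ∈ φ e ⟨ n ⟩↓ ] Σ[ z ∈ (ψ χ ↓) (φ-value d) ] El (R n (ψ-value χ z))) ∥
    oracle-choice R R-total = ∥∥-map
      (λ (e , total) → e , λ n h →
        let d , x = total n (∥∥-rec ¬-irrelevant pure (code n h))
            z = ψ↓-stable (φ-value d)
                  (¬¬-map (λ (_ , (ks , m , r , _) , _) → ks , m , r) (reveal x))
        -- Since `R n` is stable, the hidden witness may be named and replaced by the value of `ψ`.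
        in d , z , El-stable (R n _) (do
             _ , code , y ← reveal x
             eq ← Codes⇒ψ-value code z
             pure (subst (El ∘ R n) (sym eq) y)))
      (CC (λ n e → ⌜ Coded n e ⌝)
        (λ n h → code n (h >>= λ (_ , x) → ¬¬-map (λ (μ , _ , y) → μ , y) (reveal x))))
      where
      Coded : ℕ → ℕ → Set
      Coded n e = Σ[ μ ∈ ○ ℕ ] Codes e μ × El (R n μ)

      code : ∀ n → ¬ ¬ (Σ[ μ ∈ ○ ℕ ] El (R n μ)) → ∥ Σ[ e ∈ ℕ ] El ⌜ Coded n e ⌝ ∥
      code n h = ∥∥-rec ∥∥-prop
        (λ (μ , y) → ∥∥-map (λ (e , C) → e , encode (¬¬-map (λ c → μ , c , y) C))
                            (codes-surjective μ))
        (R-total n h)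

mainTheorem17 : (hott : HoTT) (Ω : StablePropClassifier) (comp : Computability)
    (θ : ℕ ↔ (ℕ ⊎ ℕ × ℕ)) →
    let open Oracles hott Ω comp θ in
    MarkovInduction → ComputableChoice →
    (χ : Oracle ℕ ℕ) (R : ℕ → ○[ χ ] ℕ → Ω¬¬) →
    (∀ n → ¬ ¬ (Σ[ μ ∈ ○[ χ ] ℕ ] El (R n μ)) →
    ∥ Σ[ μ ∈ ○[ χ ] ℕ ] El (R n μ) ∥) →
    ∥ Σ[ e ∈ ℕ ] (∀ n → ¬ ¬ (Σ[ μ ∈ ○[ χ ] ℕ ] El (R n μ)) →
    Σ[ d ∈ φ e ⟨ n ⟩↓ ] Σ[ z ∈ (ψ χ ↓) (φ-value d) ]
    El (R n (ψ-value χ z))) ∥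
mainTheorem17 hott Ω comp θ = Coding.oracle-choice hott Ω comp θ
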